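{- Let $r \ge 2$ be an integer and let $n$ be a positive rational number. Let $E_1, \ldots, E_{\lceil rn \rceil}$ be (not necessarily distinct) sets of edges of an $r$-uniform hypergraph such that $\nu^*(E_i) \ge n$ for every $i = 1, \ldots, \lceil rn \rceil$. Then the family $E_1,\ldots,E_{\lceil rn\rceil}$ has a rainbow fractional matching of size $n$.
   Context: An $r$-uniform hypergraph has edges that are $r$-element subsets of a finite vertex set. For a set $E$ of edges, a fractional matching for $E$ is a function $f\colon E \to \mathbb{R}_{\ge 0}$ such that $\sum_{e \in E,\, e \ni v} f(e) \le 1$ for every vertex $v$; its size is $\sum_{e\in E} f(e)$. The fractional matching number $\nu^*(E)$ is the maximum size of a fractional matching for $E$. Given a family $E_1,\ldots,E_m$ of sets of edges, a rainbow fractional matching of size $n$ is a set of edges $\{e_1,\ldots,e_k\}$ with $e_j \in E_{\sigma(j)}$ for $j=1,\ldots,k$, where $\sigma(1),\ldots,\sigma(k)$ are distinct indices, together with a fractional matching $f\colon\{e_1,\ldots,e_k\}\to\mathbb{R}_{\ge 0}$ of size $n$.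
   Formalization: Fractional matchings take rational rather than real weights: ν*(E_i) ≥ n is read as the existence of a rational-weighted fractional matching of size at least n, and the rainbow fractional matching obtained is rational-weighted too. -}

module Defs where

open import Data.Nat using (ℕ; zero; suc)
open import Data.Fin using (Fin; zero; suc)
open import Data.Fin.Subset using (Subset; Side; inside; outside; ∣_∣)
open import Data.Vec using (lookup)
open import Data.List using (List; length)
import Data.List as List
open import Data.Rational using (ℚ; 0ℚ; 1ℚ; _+_; _≤_)
open import Data.Product using (Σ; _×_; ∃)
open import Function.Definitions using (Injective)
open import Relation.Binary.PropositionalEquality using (_≡_)

Σ[_] : (k : ℕ) → (Fin k → ℚ) → ℚ
Σ[ zero ] f = 0ℚ
Σ[ suc k ] f = f zero + Σ[ k ] (λ j → f (suc j))

at : Side → ℚ → ℚ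
at inside x = x
at outside x = 0ℚ

IsEdge : {V : ℕ} → ℕ → Subset V → Set
IsEdge r e = ∣ e ∣ ≡ r

IsFracMatching : {V k : ℕ} → (Fin k → Subset V) → (Fin k → ℚ) → Set
IsFracMatching {V} {k} e f =
  (∀ j → 0ℚ ≤ f j) × (∀ (v : Fin V) → Σ[ k ] (λ j → at (lookup (e j) v) (f j)) ≤ 1ℚ)

size : {k : ℕ} → (Fin k → ℚ) → ℚ
size {k} f = Σ[ k ] f

-- A set of edges E (given as a finite list); "ν*(E) ≥ n" means
-- E has a fractional matching of size at least n (ν* is a maximum).
νStar≥ : {V : ℕ} → List (Subset V) → ℚ → Set
νStar≥ E n = Σ (Fin (length E) → ℚ) λ f →
  IsFracMatching (List.lookup E) f × (n ≤ size f)

RainbowFracMatching : {V m : ℕ} → (Fin m → List (Subset V)) → ℚ → Set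
RainbowFracMatching {V} {m} E n =
  Σ ℕ λ k → Σ (Fin k → Fin m) λ σ → Σ (Fin k → Subset V) λ e →
  Σ (Fin k → ℚ) λ f →
    Injective _≡_ _≡_ σ
    × (∀ j → e j Data.List.Membership.Propositional.∈ E (σ j))
    × IsFracMatching e f
    × size f ≡ n
  where import Data.List.Membership.Propositional

{-# OPTIONS --safe #-}

-- The linear program is max Σ f over the fractional matchings of the disjoint union of the
-- coloured edges. Run the simplex method on it, keeping the edges in the basis of distinct
-- colours. A basis has dual weights w on the vertices. If w(v) < 0, the slack variable
-- of v enters. If w ≥ 0 and Σ w ≥ n, the basic solution has size Σ w and is scaled down to n.
-- If w ≥ 0 and Σ w < n, then the basic solution saturates every vertex that has no slack in
-- the basis, so the basis has at most r Σ w < rn edges and some colour i is unused; since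
-- ν*(E i) ≥ n > Σ w, weak duality gives an edge e of E i with w(e) < 1, and e enters.
-- Perturbing the right-hand side by infinitesimals (the lexicographic rule) makes every
-- pivot increase w strictly, and w depends only on the basis, so the method stops.

module Submission where

open import Defs
open import Data.Bool using (true; false)
open import Data.Empty using (⊥; ⊥-elim)
open import Data.Fin using (Fin; zero; suc; join; combine; splitAt; funToFin; finToFun)
open import Data.Fin.Induction using (spo-noetherian)
open import Data.Fin.Properties
  using (_≟_; suc-injective; any?; all?; injective⇒≤; splitAt-join; combine-injective; finToFun-funToFin)
open import Data.Fin.Subset as Subset using (Subset)
open import Data.Integer as ℤ using (-[1+_]; +[1+_])
import Data.Integer.DivMod as ℤ
import Data.Integer.Properties as ℤ
open import Data.List using (List)
import Data.List as List
open import Data.List.Membership.Propositional using (_∈_)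
open import Data.List.Membership.Propositional.Properties using (∈-lookup)
open import Data.List.Relation.Unary.All as All using (All)
open import Data.Nat as ℕ using (ℕ; zero; suc; _≤_)
import Data.Nat.Properties as ℕ
open import Data.Product using (Σ; ∃; _×_; _,_; proj₁; proj₂)
open import Data.Rational.Base as ℚ
  using (ℚ; mkℚ; 0ℚ; 1ℚ; Positive; positive; nonNegative; ≢-nonZero; _+_; _*_; _-_; -_; 1/_; _<_; _/_;
         ceiling; toℚᵘ)
import Data.Rational.Properties as ℚ
import Data.Rational.Unnormalised as ℚᵘ
import Data.Rational.Unnormalised.Properties as ℚᵘ
open import Data.Sum as Sum using (_⊎_; inj₁; inj₂; [_,_]′)
open import Data.Sum.Properties using (inj₁-injective; inj₂-injective)
open import Data.Unit using (⊤; tt)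
open import Data.Vec using ([]; _∷_; lookup)
open import Data.Vec.Functional using (updateAt)
open import Data.Vec.Functional.Properties using (updateAt-updates; updateAt-minimal)
open import Function using (_∘_; const; flip)
open import Function.Definitions using (Injective)
open import Induction.WellFounded using (Acc; acc)
open import Level using (0ℓ)
open import Relation.Binary using (Rel; Total; Transitive; IsStrictPartialOrder; tri<; tri≈; tri>)
open import Relation.Binary.PropositionalEquality
open import Relation.Nullary using (¬_; Dec; yes; no; contradiction)
open import Relation.Nullary.Decidable using (dec⇒maybe; ¬?)
open import Tactic.RingSolver using (solve-∀)
open import Tactic.RingSolver.Core.AlmostCommutativeRing using (fromCommutativeRing; AlmostCommutativeRing)

ℚ-ring : AlmostCommutativeRing 0ℓ 0ℓ
ℚ-ring = fromCommutativeRing ℚ.+-*-commutativeRing λ x → dec⇒maybe (0ℚ ℚ.≟ x)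

private variable n m : ℕ

-- Finite sums

Σ-cong : {f g : Fin n → ℚ} → (∀ i → f i ≡ g i) → Σ[ n ] f ≡ Σ[ n ] g
Σ-cong {zero}  eq = refl
Σ-cong {suc n} eq = cong₂ _+_ (eq zero) (Σ-cong (eq ∘ suc))

Σ-zero : ∀ n → Σ[ n ] (λ _ → 0ℚ) ≡ 0ℚ
Σ-zero zero    = refl
Σ-zero (suc n) = trans (ℚ.+-identityˡ _) (Σ-zero n)

Σ-+ : ∀ n (f g : Fin n → ℚ) → Σ[ n ] (λ i → f i + g i) ≡ Σ[ n ] f + Σ[ n ] g
Σ-+ zero    f g = refl
Σ-+ (suc n) f g = trans (cong (f zero + g zero +_) (Σ-+ n (f ∘ suc) (g ∘ suc)))
  (lemma (f zero) (g zero) _ _)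
  where
  lemma : ∀ a b x y → a + b + (x + y) ≡ (a + x) + (b + y)
  lemma = solve-∀ ℚ-ring

Σ-*ˡ : ∀ n s (f : Fin n → ℚ) → Σ[ n ] (λ i → s * f i) ≡ s * Σ[ n ] f
Σ-*ˡ zero    s f = sym (ℚ.*-zeroʳ s)
Σ-*ˡ (suc n) s f = trans (cong (s * f zero +_) (Σ-*ˡ n s (f ∘ suc)))
  (sym (ℚ.*-distribˡ-+ s (f zero) _))

Σ-*ʳ : ∀ n s (f : Fin n → ℚ) → Σ[ n ] (λ i → f i * s) ≡ Σ[ n ] f * s
Σ-*ʳ n s f = trans (Σ-cong λ i → ℚ.*-comm (f i) s) (trans (Σ-*ˡ n s f) (ℚ.*-comm s _))

Σ-swap : ∀ n m (f : Fin n → Fin m → ℚ) →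
  Σ[ n ] (λ i → Σ[ m ] (f i)) ≡ Σ[ m ] (λ j → Σ[ n ] (λ i → f i j))
Σ-swap zero    m f = sym (Σ-zero m)
Σ-swap (suc n) m f = trans (cong (Σ[ m ] (f zero) +_) (Σ-swap n m (f ∘ suc))) (sym (Σ-+ m (f zero) _))

Σ-mono : ∀ n {f g : Fin n → ℚ} → (∀ i → f i ℚ.≤ g i) → Σ[ n ] f ℚ.≤ Σ[ n ] g
Σ-mono zero    le = ℚ.≤-refl
Σ-mono (suc n) le = ℚ.+-mono-≤ (le zero) (Σ-mono n (le ∘ suc))

Σ-nonneg : ∀ n {f : Fin n → ℚ} → (∀ i → 0ℚ ℚ.≤ f i) → 0ℚ ℚ.≤ Σ[ n ] f
Σ-nonneg n {f} pos = subst (ℚ._≤ Σ[ n ] f) (Σ-zero n) (Σ-mono n pos)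

term≤Σ : ∀ n {f : Fin n → ℚ} → (∀ i → 0ℚ ℚ.≤ f i) → ∀ i → f i ℚ.≤ Σ[ n ] f
term≤Σ (suc n) {f} pos zero    = subst (ℚ._≤ f zero + Σ[ n ] (f ∘ suc)) (ℚ.+-identityʳ (f zero))
  (ℚ.+-monoʳ-≤ (f zero) (Σ-nonneg n (pos ∘ suc)))
term≤Σ (suc n) {f} pos (suc i) = ℚ.≤-trans (term≤Σ n (pos ∘ suc) i)
  (subst (ℚ._≤ f zero + rest) (ℚ.+-identityˡ rest) (ℚ.+-monoˡ-≤ rest (pos zero)))
  where
  rest : ℚ
  rest = Σ[ n ] (f ∘ suc)

δ : Fin n → Fin n → ℚ
δ zero    zero    = 1ℚ
δ zero    (suc l) = 0ℚ
δ (suc k) zero    = 0ℚ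
δ (suc k) (suc l) = δ k l

δ-refl : (k : Fin n) → δ k k ≡ 1ℚ
δ-refl zero    = refl
δ-refl (suc k) = δ-refl k

δ-≢ : {k l : Fin n} → k ≢ l → δ k l ≡ 0ℚ
δ-≢ {k = zero}  {zero}  k≢l = contradiction refl k≢l
δ-≢ {k = zero}  {suc l} k≢l = refl
δ-≢ {k = suc k} {zero}  k≢l = refl
δ-≢ {k = suc k} {suc l} k≢l = δ-≢ (k≢l ∘ cong suc)

δ-sym : (k l : Fin n) → δ k l ≡ δ l k
δ-sym zero    zero    = refl
δ-sym zero    (suc l) = refl
δ-sym (suc k) zero    = refl
δ-sym (suc k) (suc l) = δ-sym k l

Σ-δ : (l : Fin n) (f : Fin n → ℚ) → Σ[ n ] (λ k → δ l k * f k) ≡ f l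
Σ-δ {suc n} zero f = begin
  1ℚ * f zero + Σ[ n ] (λ k → 0ℚ * f (suc k))
    ≡⟨ cong₂ _+_ (ℚ.*-identityˡ (f zero)) (Σ-cong λ k → ℚ.*-zeroˡ (f (suc k))) ⟩
  f zero + Σ[ n ] (λ k → 0ℚ)  ≡⟨ cong (f zero +_) (Σ-zero n) ⟩
  f zero + 0ℚ                 ≡⟨ ℚ.+-identityʳ (f zero) ⟩
  f zero                      ∎
  where open ≡-Reasoning
Σ-δ {suc n} (suc l) f = trans (cong₂ _+_ (ℚ.*-zeroˡ (f zero)) (Σ-δ l (f ∘ suc))) (ℚ.+-identityˡ _)

infix 8 _∙_
_∙_ : (Fin n → ℚ) → (Fin n → ℚ) → ℚ
_∙_ {n} x y = Σ[ n ] (λ v → x v * y v)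

∙-affine : (x t y : Fin n → ℚ) (s : ℚ) → (λ v → x v + s * t v) ∙ y ≡ x ∙ y + s * (t ∙ y)
∙-affine {n} x t y s = begin
  (λ v → x v + s * t v) ∙ y                  ≡⟨ Σ-cong (λ v → lemma (x v) s (t v) (y v)) ⟩
  Σ[ n ] (λ v → x v * y v + s * (t v * y v)) ≡⟨ Σ-+ n _ _ ⟩
  x ∙ y + Σ[ n ] (λ v → s * (t v * y v))     ≡⟨ cong (x ∙ y +_) (Σ-*ˡ n s _) ⟩
  x ∙ y + s * (t ∙ y)                        ∎
  where
  open ≡-Reasoning
  lemma : ∀ a s t y → (a + s * t) * y ≡ a * y + s * (t * y)
  lemma = solve-∀ ℚ-ring

-- Interchange of two summations. It rewrites `weight T ∙ y` as a sum over the basis, and with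
-- indicator vectors it is the double counting behind weak duality.
combination-∙ : (x : Fin m → Fin n → ℚ) (c : Fin m → ℚ) (y : Fin n → ℚ) →
  (λ v → Σ[ m ] (λ k → x k v * c k)) ∙ y ≡ Σ[ m ] (λ k → x k ∙ y * c k)
combination-∙ {m} {n} x c y = begin
  Σ[ n ] (λ v → Σ[ m ] (λ k → x k v * c k) * y v)  ≡⟨ Σ-cong (λ v → sym (Σ-*ʳ m (y v) _)) ⟩
  Σ[ n ] (λ v → Σ[ m ] (λ k → x k v * c k * y v))  ≡⟨ Σ-swap n m _ ⟩
  Σ[ m ] (λ k → Σ[ n ] (λ v → x k v * c k * y v))
    ≡⟨ Σ-cong (λ k → trans (Σ-cong λ v → lemma (x k v) (c k) (y v)) (Σ-*ʳ n (c k) _)) ⟩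
  Σ[ m ] (λ k → x k ∙ y * c k)                     ∎
  where
  open ≡-Reasoning
  lemma : ∀ x c y → x * c * y ≡ x * y * c
  lemma = solve-∀ ℚ-ring

-- Rational arithmetic

-- Made total by the value 0 at 0, so that every row has a ratio and `argmin` gets a total relation
-- on the rows; only rows with positive direction compete.
recip : ℚ → ℚ
recip q with q ℚ.≟ 0ℚ
... | yes _  = 0ℚ
... | no q≢0 = 1/_ q {{≢-nonZero q≢0}}

recip-inverse : {q : ℚ} → 0ℚ < q → recip q * q ≡ 1ℚ
recip-inverse {q} 0<q with q ℚ.≟ 0ℚ
... | yes refl = contradiction 0<q (ℚ.<-irrefl refl)
... | no q≢0  = ℚ.*-inverseˡ q {{≢-nonZero q≢0}}

*-pos : {p q : ℚ} → 0ℚ < p → 0ℚ < q → 0ℚ < p * q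
*-pos {p} {q} 0<p 0<q = ℚ.positive⁻¹ (p * q) {{ℚ.pos*pos⇒pos p {{positive 0<p}} q {{positive 0<q}}}}

*-nonneg : {p q : ℚ} → 0ℚ ℚ.≤ p → 0ℚ ℚ.≤ q → 0ℚ ℚ.≤ p * q
*-nonneg {p} {q} 0≤p 0≤q = ℚ.nonNegative⁻¹ (p * q)
  {{ℚ.nonNeg*nonNeg⇒nonNeg p {{nonNegative 0≤p}} q {{nonNegative 0≤q}}}}

recip-pos : {q : ℚ} → 0ℚ < q → 0ℚ < recip q
recip-pos {q} 0<q with q ℚ.≟ 0ℚ
... | yes refl = contradiction 0<q (ℚ.<-irrefl refl)
... | no q≢0  = ℚ.positive⁻¹ (1/_ q {{≢-nonZero q≢0}}) {{ℚ.1/pos⇒pos q {{positive 0<q}}}}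

<⇒0<- : {p q : ℚ} → p < q → 0ℚ < q - p
<⇒0<- {p} {q} p<q = subst (_< q - p) (ℚ.+-inverseʳ p) (ℚ.+-monoˡ-< (- p) p<q)

+-cancelˡ-≤ : ∀ p {q r : ℚ} → p + q ℚ.≤ p + r → q ℚ.≤ r
+-cancelˡ-≤ p {q} {r} le = subst₂ ℚ._≤_ (lemma p q) (lemma p r) (ℚ.+-monoʳ-≤ (- p) le)
  where
  lemma : ∀ p q → - p + (p + q) ≡ q
  lemma = solve-∀ ℚ-ring

-- Lexicographic cones

-- The vectors with positive first nonzero entry; B decides about the zero vector.
LexCone : Set → ∀ n → (Fin n → ℚ) → Set
LexCone B zero    x = B
LexCone B (suc n) x = 0ℚ < x zero ⊎ (x zero ≡ 0ℚ × LexCone B n (x ∘ suc))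

private variable B B′ B″ : Set

LexCone-cong : ∀ n {x y : Fin n → ℚ} → (∀ i → x i ≡ y i) → LexCone B n x → LexCone B n y
LexCone-cong zero    eq b             = b
LexCone-cong (suc n) eq (inj₁ 0<x)    = inj₁ (subst (0ℚ <_) (eq zero) 0<x)
LexCone-cong (suc n) eq (inj₂ (z , l)) = inj₂ (trans (sym (eq zero)) z , LexCone-cong n (eq ∘ suc) l)

-- The three parameters let one proof serve both the weak cones (`⊤`) and the strict ones (`⊥`).
LexCone-+ : {x y : Fin n → ℚ} → (B → B′ → B″) →
  LexCone B n x → LexCone B′ n y → LexCone B″ n (λ i → x i + y i)
LexCone-+ {zero}  f b b′ = f b b′
LexCone-+ {suc n} f (inj₁ p) (inj₁ q) = inj₁ (ℚ.+-mono-< p q)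
LexCone-+ {suc n} f (inj₁ p) (inj₂ (z , _)) = inj₁ (ℚ.+-mono-<-≤ p (ℚ.≤-reflexive (sym z)))
LexCone-+ {suc n} f (inj₂ (z , _)) (inj₁ q) = inj₁ (ℚ.+-mono-≤-< (ℚ.≤-reflexive (sym z)) q)
LexCone-+ {suc n} f (inj₂ (z , l)) (inj₂ (z′ , l′)) = inj₂ (cong₂ _+_ z z′ , LexCone-+ f l l′)

LexCone-* : {x : Fin n → ℚ} {s : ℚ} → 0ℚ < s → LexCone B n x → LexCone B n (λ i → s * x i)
LexCone-* {zero}  0<s b = b
LexCone-* {suc n} 0<s (inj₁ p) = inj₁ (*-pos 0<s p)
LexCone-* {suc n} {s = s} 0<s (inj₂ (z , l)) =
  inj₂ (trans (cong (s *_) z) (ℚ.*-zeroʳ s) , LexCone-* {n} 0<s l)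

LexCone-total : (x : Fin n → ℚ) → LexCone ⊤ n x ⊎ LexCone ⊤ n (λ i → - x i)
LexCone-total {zero}  x = inj₁ tt
LexCone-total {suc n} x with ℚ.<-cmp 0ℚ (x zero)
... | tri< p _ _ = inj₁ (inj₁ p)
... | tri> _ _ q = inj₂ (inj₁ (ℚ.neg-antimono-< q))
... | tri≈ _ z _ with LexCone-total (x ∘ suc)
...   | inj₁ l = inj₁ (inj₂ (sym z , l))
...   | inj₂ l = inj₂ (inj₂ (cong -_ (sym z) , l))

LexCone-positive : (x : Fin n → ℚ) → LexCone ⊤ n x → LexCone ⊥ n x ⊎ (∀ i → x i ≡ 0ℚ)
LexCone-positive {zero}  x l              = inj₂ λ ()
LexCone-positive {suc n} x (inj₁ p)       = inj₁ (inj₁ p)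
LexCone-positive {suc n} x (inj₂ (z , l)) with LexCone-positive (x ∘ suc) l
... | inj₁ l′ = inj₁ (inj₂ (z , l′))
... | inj₂ zs = inj₂ λ { zero → z ; (suc i) → zs i }

LexCone-zero : LexCone ⊥ n (λ _ → 0ℚ) → ⊥
LexCone-zero {suc n} (inj₁ p)       = ℚ.<-irrefl refl p
LexCone-zero {suc n} (inj₂ (_ , l)) = LexCone-zero {n} l

argmin : {P : Fin n → Set} → (∀ i → Dec (P i)) →
  {_≼_ : Rel (Fin n) 0ℓ} → Total _≼_ → Transitive _≼_ →
  (∃ λ p → P p × ∀ j → P j → p ≼ j) ⊎ (∀ j → ¬ P j)
argmin {zero}  P? tot tr = inj₂ λ ()
argmin {suc n} P? {_≼_} tot tr
  with argmin (P? ∘ suc) {λ i j → suc i ≼ suc j} (λ i j → tot (suc i) (suc j)) tr | P? zero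
... | inj₁ (p , Pp , min) | no ¬P₀ =
  inj₁ (suc p , Pp , λ { zero P₀ → contradiction P₀ ¬P₀ ; (suc j) → min j })
... | inj₂ none | no ¬P₀ = inj₂ λ { zero → ¬P₀ ; (suc j) → none j }
... | inj₂ none | yes P₀ = inj₁ (zero , P₀ , λ
  -- Reflexivity is extracted from totality at the pair `zero`, `zero`.
  { zero _ → [ (λ z → z) , (λ z → z) ]′ (tot zero zero)
  ; (suc j) Pj → contradiction Pj (none j) })
... | inj₁ (p , Pp , min) | yes P₀ with tot zero (suc p)
...   | inj₁ 0≼p = inj₁ (zero , P₀ , λ
  { zero _ → [ (λ z → z) , (λ z → z) ]′ (tot zero zero)
  ; (suc j) Pj → tr 0≼p (min j Pj) })
...   | inj₂ p≼0 = inj₁ (suc p , Pp , λ { zero _ → p≼0 ; (suc j) → min j })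

-- The lexicographic simplex method

-- The program maximises the cost `c` of a nonnegative combination of the columns `a j` that equals
-- the all-ones vector. A basis is a map `β` choosing `d` columns.
module Simplex {J : Set} {d : ℕ} (a : J → Fin d → ℚ) (c : J → ℚ) where

  private variable x y z : Fin d → ℚ

  -- The value of x at the perturbed right-hand side (1 + ε, 1 + ε², …), as the list of
  -- its coefficients at 1, ε, ε², ….
  perturbed : (Fin d → ℚ) → Fin (suc d) → ℚ
  perturbed x zero    = Σ[ d ] x
  perturbed x (suc v) = x v

  Lex : Set → (Fin d → ℚ) → Set
  Lex B x = LexCone B (suc d) (perturbed x)

  perturbed-cong : (∀ v → x v ≡ y v) → ∀ i → perturbed x i ≡ perturbed y i
  perturbed-cong eq zero    = Σ-cong eq
  perturbed-cong eq (suc v) = eq v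

  Lex-cong : (∀ v → x v ≡ y v) → Lex B x → Lex B y
  Lex-cong eq = LexCone-cong (suc d) (perturbed-cong eq)

  Lex-+ : (B → B′ → B″) → Lex B x → Lex B′ y → Lex B″ (λ v → x v + y v)
  Lex-+ {x = x} {y = y} f l l′ = LexCone-cong (suc d)
    {x = λ i → perturbed x i + perturbed y i} {perturbed (λ v → x v + y v)}
    (λ { zero → sym (Σ-+ d x y) ; (suc v) → refl })
    (LexCone-+ {x = perturbed x} {perturbed y} f l l′)

  Lex-* : {s : ℚ} → 0ℚ < s → Lex B x → Lex B (λ v → s * x v)
  Lex-* {x = x} {s = s} 0<s l = LexCone-cong (suc d) {x = λ i → s * perturbed x i} {perturbed (λ v → s * x v)}
    (λ { zero → sym (Σ-*ˡ d s x) ; (suc v) → refl })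
    (LexCone-* {x = perturbed x} 0<s l)

  infix 4 _≼_ _≺_
  _≼_ _≺_ : Rel (Fin d → ℚ) 0ℓ
  x ≼ y = Lex ⊤ (λ v → y v - x v)
  x ≺ y = Lex ⊥ (λ v → y v - x v)

  private
    telescope : ∀ x y z → (y - x) + (z - y) ≡ z - x
    telescope = solve-∀ ℚ-ring

  ≼-trans : ∀ x y z → x ≼ y → y ≼ z → x ≼ z
  ≼-trans x y z p q = Lex-cong (λ v → telescope (x v) (y v) (z v))
    (Lex-+ {x = λ v → y v - x v} {y = λ v → z v - y v} _ p q)

  ≺-trans : ∀ x y z → x ≺ y → y ≺ z → x ≺ z
  ≺-trans x y z p q = Lex-cong (λ v → telescope (x v) (y v) (z v))
    (Lex-+ {x = λ v → y v - x v} {y = λ v → z v - y v} const p q)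

  ≼-total : ∀ x y → x ≼ y ⊎ y ≼ x
  ≼-total x y with LexCone-total (perturbed (λ v → y v - x v))
  ... | inj₁ l = inj₁ l
  ... | inj₂ l = inj₂ (LexCone-cong (suc d)
    {x = λ i → - perturbed (λ v → y v - x v) i} {perturbed (λ v → x v - y v)}
    (λ { zero    → trans (negate (Σ[ d ] (λ v → y v - x v)))
                     (trans (sym (Σ-*ˡ d (- 1ℚ) (λ v → y v - x v))) (Σ-cong λ v → swap (x v) (y v)))
       ; (suc v) → swap′ (x v) (y v) }) l)
    where
    negate : ∀ x → - x ≡ - 1ℚ * x
    negate = solve-∀ ℚ-ring
    swap : ∀ x y → - 1ℚ * (y - x) ≡ x - y
    swap = solve-∀ ℚ-ring
    swap′ : ∀ x y → - (y - x) ≡ x - y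
    swap′ = solve-∀ ℚ-ring

  ≺-irrefl : (∀ v → x v ≡ y v) → ¬ x ≺ y
  ≺-irrefl {x} {y} eq p = LexCone-zero {suc d} (LexCone-cong (suc d)
    {x = perturbed (λ v → y v - x v)} {λ _ → 0ℚ}
    (λ { zero → trans (Σ-cong zeros) (Σ-zero d) ; (suc v) → zeros v }) p)
    where
    zeros : ∀ v → y v - x v ≡ 0ℚ
    zeros v = trans (cong (λ h → y v - h) (eq v)) (ℚ.+-inverseʳ (y v))

  -- `ρ` is the inverse of the matrix with columns `a (β k)`; carrying both inverse laws lets a
  -- pivot update each of them directly. `feasible` is nonnegativity of the basic solution at the
  -- perturbed right-hand side.
  record Tableau (β : Fin d → J) : Set where
    field
      ρ        : Fin d → Fin d → ℚ
      left     : ∀ k l → ρ k ∙ a (β l) ≡ δ k l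
      right    : ∀ u v → Σ[ d ] (λ k → ρ k u * a (β k) v) ≡ δ u v
      feasible : ∀ k → Lex ⊤ (ρ k)

    -- The dual solution: it prices every basic column at its cost, so `c q - weight ∙ a q` is the
    -- reduced cost of `q`.
    weight : Fin d → ℚ
    weight v = Σ[ d ] (λ k → ρ k v * c (β k))

    -- By `right`, the numbers `ρ k ∙ y` are the coordinates of `y` in the basis. For an entering
    -- column they are its directions, for the all-ones vector the basic solution.
    expansion : ∀ y v → Σ[ d ] (λ k → ρ k ∙ y * a (β k) v) ≡ y v
    expansion y v = begin
      Σ[ d ] (λ k → ρ k ∙ y * a (β k) v)               ≡⟨ combination-∙ ρ (λ k → a (β k) v) y ⟨
      Σ[ d ] (λ u → Σ[ d ] (λ k → ρ k u * a (β k) v) * y u)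
        ≡⟨ Σ-cong (λ u → cong (_* y u) (trans (right u v) (δ-sym u v))) ⟩
      Σ[ d ] (λ u → δ v u * y u)                       ≡⟨ Σ-δ v y ⟩
      y v                                              ∎
      where open ≡-Reasoning

  open Tableau

  -- Uniqueness of inverses: `rows` evaluates the product of `ρ T′`, the basis matrix and `ρ T` in
  -- two ways, by `left T′` and by `right T`. Hence the weights depend on the basis alone.
  weight-unique : ∀ {β β′} (T : Tableau β) (T′ : Tableau β′) → (∀ k → β k ≡ β′ k) →
    ∀ v → weight T v ≡ weight T′ v
  weight-unique {β} {β′} T T′ eq v = Σ-cong λ k → cong₂ _*_ (rows k) (cong c (eq k))
    where
    open ≡-Reasoning
    rows : ∀ k → ρ T k v ≡ ρ T′ k v
    rows k = begin
      ρ T k v                                              ≡⟨ Σ-δ k (λ l → ρ T l v) ⟨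
      Σ[ d ] (λ l → δ k l * ρ T l v)                        ≡⟨ Σ-cong (λ l → trans
        (ℚ.*-comm (δ k l) (ρ T l v))
        (cong (ρ T l v *_) (trans (sym (left T′ k l)) (trans (cong (λ j → ρ T′ k ∙ a j) (sym (eq l)))
          (Σ-cong λ u → ℚ.*-comm (ρ T′ k u) (a (β l) u)))))) ⟩
      Σ[ d ] (λ l → ρ T l v * Σ[ d ] (λ u → a (β l) u * ρ T′ k u))
        ≡⟨ Σ-cong (λ l → trans (sym (Σ-*ˡ d (ρ T l v) _)) (Σ-cong λ u → sym (ℚ.*-assoc (ρ T l v) (a (β l) u) (ρ T′ k u)))) ⟩
      Σ[ d ] (λ l → Σ[ d ] (λ u → ρ T l v * a (β l) u * ρ T′ k u)) ≡⟨ Σ-swap d d _ ⟩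
      Σ[ d ] (λ u → Σ[ d ] (λ l → ρ T l v * a (β l) u * ρ T′ k u))
        ≡⟨ Σ-cong (λ u → trans (Σ-*ʳ d (ρ T′ k u) _) (cong (_* ρ T′ k u) (right T v u))) ⟩
      Σ[ d ] (λ u → δ v u * ρ T′ k u)                       ≡⟨ Σ-δ v (ρ T′ k) ⟩
      ρ T′ k v                                             ∎

  -- Pivoting

  exchange : (Fin d → J) → Fin d → J → Fin d → J
  exchange β p q = updateAt β p (const q)

  -- Turns the case distinction of an exchange into a correction by `δ p k`, so that sums over the
  -- new basis can be expanded by ring arithmetic.
  exchange-∘ : ∀ β p q (h : J → ℚ) k →
    h (exchange β p q k) ≡ h (β k) + δ p k * (h q - h (β p))
  exchange-∘ β p q h k with k ≟ p
  ... | yes refl = trans (cong h (updateAt-updates p β)) (trans (lemma (h q) (h (β p)))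
        (cong (λ e → h (β p) + e * (h q - h (β p))) (sym (δ-refl p))))
    where
    lemma : ∀ x y → x ≡ y + 1ℚ * (x - y)
    lemma = solve-∀ ℚ-ring
  ... | no k≢p = trans (cong h (updateAt-minimal k p β k≢p)) (trans (lemma (h (β k)) (h q - h (β p)))
        (cong (λ e → h (β k) + e * (h q - h (β p))) (sym (δ-≢ (k≢p ∘ sym)))))
    where
    lemma : ∀ x y → x ≡ x + 0ℚ * y
    lemma = solve-∀ ℚ-ring

  module Pivot {β : Fin d → J} (T : Tableau β) (p : Fin d) (q : J)
    (0<dₚ : 0ℚ < ρ T p ∙ a q)
    (ratio-test : ∀ k → 0ℚ < ρ T k ∙ a q →
      (λ v → recip (ρ T p ∙ a q) * ρ T p v) ≼ (λ v → recip (ρ T k ∙ a q) * ρ T k v))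
    where

    direction : Fin d → ℚ
    direction k = ρ T k ∙ a q

    t : Fin d → ℚ
    t v = recip (direction p) * ρ T p v

    -- One formula for both kinds of row in Gaussian elimination: row `p` becomes `t`, and every
    -- other row loses `direction k` times `t`.
    ρ′ : Fin d → Fin d → ℚ
    ρ′ k v = ρ T k v + (δ p k - direction k) * t v

    t-∙ : ∀ y → t ∙ y ≡ recip (direction p) * ρ T p ∙ y
    t-∙ y = trans (Σ-cong λ v → ℚ.*-assoc (recip (direction p)) (ρ T p v) (y v)) (Σ-*ˡ d (recip (direction p)) _)

    ρₚ≡ : ∀ v → ρ T p v ≡ direction p * t v
    ρₚ≡ v = trans (sym (ℚ.*-identityˡ _)) (trans (cong (_* ρ T p v) (sym (recip-inverse 0<dₚ)))
      (lemma (recip (direction p)) (direction p) (ρ T p v)))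
      where
      lemma : ∀ r e x → r * e * x ≡ e * (r * x)
      lemma = solve-∀ ℚ-ring

    -- The effect of a pivot on any quantity `g` of the basic columns, with value `γ` on the
    -- entering one. Column entries in place of `g` yield `right′`, costs yield the change of the
    -- weights.
    exchange-Σ : ∀ (g : Fin d → ℚ) γ v →
      Σ[ d ] (λ k → ρ′ k v * (g k + δ p k * (γ - g p))) ≡
      Σ[ d ] (λ k → ρ T k v * g k) + t v * (γ - Σ[ d ] (λ k → direction k * g k))
    exchange-Σ g γ v = begin
      Σ[ d ] (λ k → ρ′ k v * (g k + δ p k * (γ - g p)))
        ≡⟨ Σ-cong (λ k → expand (ρ T k v) (δ p k) (direction k) (t v) (g k) (γ - g p)) ⟩
      Σ[ d ] (λ k → ρ T k v * g k + - t v * (direction k * g k) + δ p k * correction k)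
        ≡⟨ Σ-+ d _ _ ⟩
      Σ[ d ] (λ k → ρ T k v * g k + - t v * (direction k * g k)) + Σ[ d ] (λ k → δ p k * correction k)
        ≡⟨ cong₂ _+_ (trans (Σ-+ d _ _) (cong (Σ[ d ] (λ k → ρ T k v * g k) +_) (Σ-*ˡ d (- t v) _)))
                     (Σ-δ p correction) ⟩
      Σ[ d ] (λ k → ρ T k v * g k) + - t v * Σ[ d ] (λ k → direction k * g k) + correction p
        ≡⟨ cong (Σ[ d ] (λ k → ρ T k v * g k) + - t v * Σ[ d ] (λ k → direction k * g k) +_)
             (cong₂ (λ x e → x * (γ - g p) + t v * g p + e * t v * (γ - g p) - direction p * t v * (γ - g p))
               (ρₚ≡ v) (δ-refl p)) ⟩
      Σ[ d ] (λ k → ρ T k v * g k) + - t v * Σ[ d ] (λ k → direction k * g k)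
        + (direction p * t v * (γ - g p) + t v * g p + 1ℚ * t v * (γ - g p) - direction p * t v * (γ - g p))
        ≡⟨ collect (Σ[ d ] (λ k → ρ T k v * g k)) (t v) (Σ[ d ] (λ k → direction k * g k))
             (direction p) γ (g p) ⟩
      Σ[ d ] (λ k → ρ T k v * g k) + t v * (γ - Σ[ d ] (λ k → direction k * g k)) ∎
      where
      open ≡-Reasoning
      -- The terms with a factor `δ p k`. `Σ-δ` leaves their value at `p`, where `ρₚ≡` makes the
      -- first and the last summand cancel.
      correction : Fin d → ℚ
      correction k = ρ T k v * (γ - g p) + t v * g k + δ p k * t v * (γ - g p) - direction k * t v * (γ - g p)
      expand : ∀ r δ e t g D → (r + (δ - e) * t) * (g + δ * D) ≡
        r * g + - t * (e * g) + δ * (r * D + t * g + δ * t * D - e * t * D)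
      expand = solve-∀ ℚ-ring
      collect : ∀ s t w e γ g → s + - t * w + (e * t * (γ - g) + t * g + 1ℚ * t * (γ - g) - e * t * (γ - g))
        ≡ s + t * (γ - w)
      collect = solve-∀ ℚ-ring

    -- The vector `t` pairs to 1 with the entering column and to 0 with each basic column that
    -- stays, so adding multiples of `t` repairs exactly the column at `p`.
    left′ : ∀ k l → ρ′ k ∙ a (exchange β p q l) ≡ δ k l
    left′ k l with l ≟ p
    ... | yes refl = begin
      ρ′ k ∙ a (exchange β p q p)               ≡⟨ cong (λ j → ρ′ k ∙ a j) (updateAt-updates p β) ⟩
      ρ′ k ∙ a q                                ≡⟨ ∙-affine (ρ T k) t (a q) (δ p k - direction k) ⟩
      direction k + (δ p k - direction k) * (t ∙ a q)
        ≡⟨ cong (λ e → direction k + (δ p k - direction k) * e) (trans (t-∙ (a q)) (recip-inverse 0<dₚ)) ⟩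
      direction k + (δ p k - direction k) * 1ℚ  ≡⟨ lemma (direction k) (δ p k) ⟩
      δ p k                                     ≡⟨ δ-sym p k ⟩
      δ k p                                     ∎
      where
      open ≡-Reasoning
      lemma : ∀ e δ → e + (δ - e) * 1ℚ ≡ δ
      lemma = solve-∀ ℚ-ring
    ... | no l≢p = begin
      ρ′ k ∙ a (exchange β p q l)  ≡⟨ cong (λ j → ρ′ k ∙ a j) (updateAt-minimal l p β l≢p) ⟩
      ρ′ k ∙ a (β l)               ≡⟨ ∙-affine (ρ T k) t (a (β l)) (δ p k - direction k) ⟩
      ρ T k ∙ a (β l) + (δ p k - direction k) * (t ∙ a (β l))
        ≡⟨ cong₂ (λ x e → x + (δ p k - direction k) * e) (left T k l)
             (trans (t-∙ (a (β l))) (cong (recip (direction p) *_) (trans (left T p l) (δ-≢ (l≢p ∘ sym))))) ⟩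
      δ k l + (δ p k - direction k) * (recip (direction p) * 0ℚ) ≡⟨ lemma (δ k l) (δ p k - direction k) (recip (direction p)) ⟩
      δ k l ∎
      where
      open ≡-Reasoning
      lemma : ∀ x e r → x + e * (r * 0ℚ) ≡ x
      lemma = solve-∀ ℚ-ring

    right′ : ∀ u v → Σ[ d ] (λ k → ρ′ k u * a (exchange β p q k) v) ≡ δ u v
    right′ u v = begin
      Σ[ d ] (λ k → ρ′ k u * a (exchange β p q k) v)
        ≡⟨ Σ-cong (λ k → cong (ρ′ k u *_) (exchange-∘ β p q (λ j → a j v) k)) ⟩
      Σ[ d ] (λ k → ρ′ k u * (a (β k) v + δ p k * (a q v - a (β p) v)))
        ≡⟨ exchange-Σ (λ k → a (β k) v) (a q v) u ⟩
      Σ[ d ] (λ k → ρ T k u * a (β k) v) + t u * (a q v - Σ[ d ] (λ k → direction k * a (β k) v))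
        ≡⟨ cong₂ (λ x e → x + t u * (a q v - e)) (right T u v) (expansion T (a q) v) ⟩
      δ u v + t u * (a q v - a q v) ≡⟨ lemma (δ u v) (t u) (a q v) ⟩
      δ u v ∎
      where
      open ≡-Reasoning
      lemma : ∀ x t y → x + t * (y - y) ≡ x
      lemma = solve-∀ ℚ-ring

    -- Row `p` becomes `t`, a positive multiple of the old row. Another row is, by the sign of its
    -- direction, a positive multiple of a difference of ratios (the ratio test), unchanged, or
    -- increased by a positive multiple of `t`.
    feasible′ : ∀ k → Lex ⊤ (ρ′ k)
    feasible′ k with k ≟ p
    ... | yes refl = Lex-cong row (Lex-* {x = ρ T p} (recip-pos 0<dₚ) (feasible T p))
      where
      lemma : ∀ e t → t ≡ e * t + (1ℚ - e) * t
      lemma = solve-∀ ℚ-ring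
      row : ∀ v → t v ≡ ρ′ p v
      row v = trans (lemma (direction p) (t v))
        (cong₂ (λ x e → x + (e - direction p) * t v) (sym (ρₚ≡ v)) (sym (δ-refl p)))
    ... | no k≢p with ℚ.<-cmp 0ℚ (direction k)
    ...   | tri< 0<dₖ _ _ = Lex-cong row (Lex-* 0<dₖ (ratio-test k 0<dₖ))
      where
      lemma : ∀ e r x t → e * (r * x - t) ≡ r * e * x + (0ℚ - e) * t
      lemma = solve-∀ ℚ-ring
      row : ∀ v → direction k * (recip (direction k) * ρ T k v - t v) ≡ ρ′ k v
      row v = trans (lemma (direction k) (recip (direction k)) (ρ T k v) (t v))
        (cong₂ (λ x e → x + (e - direction k) * t v)
          (trans (cong (_* ρ T k v) (recip-inverse 0<dₖ)) (ℚ.*-identityˡ (ρ T k v))) (sym (δ-≢ (k≢p ∘ sym))))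
    ...   | tri≈ _ dₖ≡0 _ = Lex-cong row (feasible T k)
      where
      lemma : ∀ x t → x ≡ x + (0ℚ - 0ℚ) * t
      lemma = solve-∀ ℚ-ring
      row : ∀ v → ρ T k v ≡ ρ′ k v
      row v = trans (lemma (ρ T k v) (t v))
        (cong₂ (λ e e′ → ρ T k v + (e - e′) * t v) (sym (δ-≢ (k≢p ∘ sym))) dₖ≡0)
    ...   | tri> _ _ dₖ<0 = Lex-cong row
        (Lex-+ {x = ρ T k} _ (feasible T k) (Lex-* {x = t} (ℚ.neg-antimono-< dₖ<0)
          (Lex-* {x = ρ T p} (recip-pos 0<dₚ) (feasible T p))))
      where
      lemma : ∀ x e t → x + - e * t ≡ x + (0ℚ - e) * t
      lemma = solve-∀ ℚ-ring
      row : ∀ v → ρ T k v + - direction k * t v ≡ ρ′ k v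
      row v = trans (lemma (ρ T k v) (direction k) (t v))
        (cong (λ e → ρ T k v + (e - direction k) * t v) (sym (δ-≢ (k≢p ∘ sym))))

    pivoted : Tableau (exchange β p q)
    pivoted = record { ρ = ρ′ ; left = left′ ; right = right′ ; feasible = feasible′ }

    -- `t` is lexicographically nonnegative, and it is nonzero because it pairs to 1 with `a q`.
    -- Here the perturbation excludes degenerate pivots.
    t-positive : Lex ⊥ t
    t-positive with LexCone-positive (perturbed t) (Lex-* {x = ρ T p} (recip-pos 0<dₚ) (feasible T p))
    ... | inj₁ l  = l
    ... | inj₂ zs = contradiction
      (trans (sym (trans (t-∙ (a q)) (recip-inverse 0<dₚ)))
        (trans (Σ-cong λ v → trans (cong (_* a q v) (zs (suc v))) (ℚ.*-zeroˡ (a q v))) (Σ-zero d)))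
      ℚ.1≢0

    -- By `exchange-Σ` the weights move by the reduced cost of `q` times `t`, a positive multiple of
    -- a lexicographically positive vector.
    weight-increases : weight T ∙ a q < c q → weight T ≺ weight pivoted
    weight-increases lt = Lex-cong (λ v → sym (gain v)) (Lex-* {x = t} (<⇒0<- lt) t-positive)
      where
      open ≡-Reasoning
      lemma : ∀ w t e → w + t * e - w ≡ e * t
      lemma = solve-∀ ℚ-ring
      gain : ∀ v → weight pivoted v - weight T v ≡ (c q - weight T ∙ a q) * t v
      gain v = begin
        weight pivoted v - weight T v
          ≡⟨ cong (_- weight T v) (trans (Σ-cong λ k → cong (ρ′ k v *_) (exchange-∘ β p q c k))
               (exchange-Σ (c ∘ β) (c q) v)) ⟩
        weight T v + t v * (c q - Σ[ d ] (λ k → direction k * c (β k))) - weight T v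
          ≡⟨ cong (λ e → weight T v + t v * (c q - e) - weight T v)
               (sym (combination-∙ (ρ T) (c ∘ β) (a q))) ⟩
        weight T v + t v * (c q - weight T ∙ a q) - weight T v ≡⟨ lemma (weight T v) (t v) _ ⟩
        (c q - weight T ∙ a q) * t v ∎

  module _ (a-nonneg : ∀ j v → 0ℚ ℚ.≤ a j v) where

    -- Otherwise `expansion` writes `a q` as a combination of nonnegative columns with coefficients
    -- at most 0, against its positive entry sum. So the program is never unbounded along `q`.
    some-direction-positive : ∀ {β} (T : Tableau β) q → 0ℚ < Σ[ d ] (a q) → ¬ (∀ k → ¬ 0ℚ < ρ T k ∙ a q)
    some-direction-positive {β} T q 0<a none = ℚ.<-irrefl refl (ℚ.<-≤-trans 0<a
      (subst (Σ[ d ] (a q) ℚ.≤_) (Σ-zero d) (Σ-mono d λ v → subst₂ ℚ._≤_ (expansion T (a q) v) (Σ-zero d)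
        (Σ-mono d λ k → subst (ρ T k ∙ a q * a (β k) v ℚ.≤_) (ℚ.*-zeroˡ (a (β k) v))
          (ℚ.*-monoʳ-≤-nonNeg (a (β k) v) {{nonNegative (a-nonneg (β k) v)}} (ℚ.≮⇒≥ (none k)))))))

    pivot : ∀ {β} (T : Tableau β) q → 0ℚ < Σ[ d ] (a q) → weight T ∙ a q < c q →
      ∃ λ p → Σ (Tableau (exchange β p q)) λ T′ → weight T ≺ weight T′
    pivot {β} T q 0<a lt = [ leave , (λ none → ⊥-elim (some-direction-positive T q 0<a none)) ]′
      (argmin {P = λ k → 0ℚ < ρ T k ∙ a q} (λ k → 0ℚ ℚ.<? ρ T k ∙ a q) {λ k l → ratio k ≼ ratio l}
        (λ k l → ≼-total (ratio k) (ratio l))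
        (λ {i} {j} {k} → ≼-trans (ratio i) (ratio j) (ratio k)))
      where
      ratio : Fin d → Fin d → ℚ
      ratio k v = recip (ρ T k ∙ a q) * ρ T k v

      leave : (∃ λ p → 0ℚ < ρ T p ∙ a q × ∀ k → 0ℚ < ρ T k ∙ a q → ratio p ≼ ratio k) →
        ∃ λ p → Σ (Tableau (exchange β p q)) λ T′ → weight T ≺ weight T′
      leave (p , 0<dₚ , min) = p , pivoted , weight-increases lt
        where open Pivot T p q 0<dₚ min

    -- Termination

    module _ {N : ℕ} (code : J → Fin N) (code-injective : Injective _≡_ _≡_ code) where

      private
        encode : (Fin d → J) → Fin (N ℕ.^ d)
        encode β = funToFin (code ∘ β)

        encode-injective : ∀ {β β′} → encode β ≡ encode β′ → ∀ k → β k ≡ β′ k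
        encode-injective {β} {β′} eq k = code-injective (trans (sym (finToFun-funToFin (code ∘ β) k))
          (trans (cong (λ e → finToFun e k) eq) (finToFun-funToFin (code ∘ β′) k)))

        -- The increase of weights, transferred from tableaux to codes of bases: on a finite set
        -- every strict partial order is noetherian.
        record _⊏_ (i j : Fin (N ℕ.^ d)) : Set where
          constructor increase
          field
            {β β′} : Fin d → J
            T      : Tableau β
            T′     : Tableau β′
            source : encode β ≡ i
            target : encode β′ ≡ j
            less   : weight T ≺ weight T′

        ⊏-irrefl : ∀ {i j} → i ≡ j → ¬ i ⊏ j
        ⊏-irrefl refl (increase T T′ refl eq lt) =
          ≺-irrefl (weight-unique T T′ (encode-injective (sym eq))) lt

        ⊏-trans : Transitive _⊏_
        ⊏-trans (increase T₁ T₂ s e lt) (increase T₃ T₄ s′ e′ lt′) = increase T₁ T₄ s e′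
          -- The middle code may carry two different tableaux, `T₂` and `T₃`; their bases agree,
          -- hence so do their weights.
          (≺-trans (weight T₁) (weight T₂) (weight T₄) lt (Lex-cong (λ v → cong (λ e → weight T₄ v - e)
            (weight-unique T₃ T₂ (encode-injective (trans s′ (sym e))) v)) lt′))

        ⊏-isStrictPartialOrder : IsStrictPartialOrder _≡_ _⊏_
        ⊏-isStrictPartialOrder = record
          { isEquivalence = isEquivalence
          ; irrefl        = ⊏-irrefl
          ; trans         = ⊏-trans
          ; <-resp-≈      = (λ { refl lt → lt }) , (λ { refl lt → lt })
          }

      -- The invariant `P` must survive the exchange at every `p`, because `step` chooses only the
      -- entering column and the ratio test chooses the leaving row.
      simplex : (P : (Fin d → J) → Set) {Q : Set} →
        (∀ {β} (T : Tableau β) → P β →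
          Q ⊎ ∃ λ q → 0ℚ < Σ[ d ] (a q) × weight T ∙ a q < c q × (∀ p → P (exchange β p q))) →
        ∀ {β} → Tableau β → P β → Q
      simplex P {Q} step T₀ = run T₀ (spo-noetherian ⊏-isStrictPartialOrder _)
        where
        run : ∀ {β} (T : Tableau β) → Acc (flip _⊏_) (encode β) → P β → Q
        run {β} T (acc rec) Pβ = [ (λ done → done) , continue ]′ (step T Pβ)
          where
          continue : (∃ λ q → 0ℚ < Σ[ d ] (a q) × weight T ∙ a q < c q × (∀ p → P (exchange β p q))) → Q
          continue (q , 0<a , lt , stays) = let p , T′ , up = pivot T q 0<a lt in
            run T′ (rec {encode (exchange β p q)} (increase T T′ refl refl up)) (stays p)

-- Matchings and weak duality

-- As a sum of ones it agrees by definition with the constant sums that arise in counting vertices,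
-- columns and edges.
ℕ→ℚ : ℕ → ℚ
ℕ→ℚ k = Σ[ k ] (λ _ → 1ℚ)

ℕ→ℚ≡/1 : ∀ k → ℕ→ℚ k ≡ (ℤ.+ k) / 1
ℕ→ℚ≡/1 zero    = refl
ℕ→ℚ≡/1 (suc k) = ℚ.toℚᵘ-injective (begin
  toℚᵘ (1ℚ + ℕ→ℚ k)               ≈⟨ ℚ.toℚᵘ-homo-+ 1ℚ (ℕ→ℚ k) ⟩
  ℚᵘ.1ℚᵘ ℚᵘ.+ toℚᵘ (ℕ→ℚ k)        ≡⟨ cong (λ q → ℚᵘ.1ℚᵘ ℚᵘ.+ toℚᵘ q) (ℕ→ℚ≡/1 k) ⟩
  ℚᵘ.1ℚᵘ ℚᵘ.+ toℚᵘ ((ℤ.+ k) / 1)    ≈⟨ ℚᵘ.+-congʳ ℚᵘ.1ℚᵘ (ℚ.toℚᵘ-fromℚᵘ (ℚᵘ.mkℚᵘ (ℤ.+ k) 0)) ⟩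
  ℚᵘ.1ℚᵘ ℚᵘ.+ ℚᵘ.mkℚᵘ (ℤ.+ k) 0     ≈⟨ ℚᵘ.*≡* (cong (λ e → e ℤ.* ℤ.+ 1) (cong (λ e → ℤ.+ 1 ℤ.+ e) (ℤ.*-identityʳ (ℤ.+ k)))) ⟩
  ℚᵘ.mkℚᵘ (ℤ.+ suc k) 0             ≈⟨ ℚ.toℚᵘ-fromℚᵘ (ℚᵘ.mkℚᵘ (ℤ.+ suc k) 0) ⟨
  toℚᵘ ((ℤ.+ suc k) / 1)            ∎)
  where open ℚᵘ.≃-Reasoning

-- The ceiling is minus the floor of `- p`, so this is the negated inequality of division with
-- remainder. `main` splits on the numerator because negation computes only on its constructors.
≤-ceiling : ∀ p → p ℚ.≤ ceiling p / 1
≤-ceiling p = ℚ.toℚᵘ-cancel-≤ (ℚᵘ.≤-respʳ-≃ (ℚᵘ.≃-sym (ℚ.toℚᵘ-fromℚᵘ (ℚᵘ.mkℚᵘ (ceiling p) 0))) (main p))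
  where
  bound : ∀ N D → ℤ.- N ℤ.* ℤ.+ 1 ℤ.≤ ℤ.- (N ℤ./ +[1+ D ]) ℤ.* +[1+ D ]
  bound N D = subst₂ ℤ._≤_ (sym (ℤ.*-identityʳ (ℤ.- N))) (ℤ.neg-distribˡ-* (N ℤ./ +[1+ D ]) +[1+ D ])
    (ℤ.neg-mono-≤ (ℤ.[n/d]*d≤n N +[1+ D ]))
  main : ∀ p → toℚᵘ p ℚᵘ.≤ ℚᵘ.mkℚᵘ (ceiling p) 0
  main (mkℚ +[1+ N ] D _) = ℚᵘ.*≤* (bound -[1+ N ] D)
  main (mkℚ (ℤ.+ 0)    D _) = ℚᵘ.*≤* (bound (ℤ.+ 0) D)
  main (mkℚ -[1+ N ] D _) = ℚᵘ.*≤* (bound +[1+ N ] D)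

-- Bridges to the number of colours, which is an absolute value: passing from an integer to its
-- absolute value never decreases it.
≤-∣ceiling∣ : ∀ p → p ℚ.≤ ℕ→ℚ ℤ.∣ ceiling p ∣
≤-∣ceiling∣ p = ℚ.≤-trans (≤-ceiling p) (subst (ceiling p / 1 ℚ.≤_) (sym (ℕ→ℚ≡/1 ℤ.∣ ceiling p ∣))
  (ℚ.toℚᵘ-cancel-≤ (ℚᵘ.≤-respʳ-≃ (ℚᵘ.≃-sym (ℚ.toℚᵘ-fromℚᵘ (ℚᵘ.mkℚᵘ (ℤ.+ ℤ.∣ ceiling p ∣) 0)))
    (ℚᵘ.≤-respˡ-≃ (ℚᵘ.≃-sym (ℚ.toℚᵘ-fromℚᵘ (ℚᵘ.mkℚᵘ (ceiling p) 0)))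
      (ℚᵘ.*≤* (ℤ.*-monoʳ-≤-nonNeg (ℤ.+ 1) (i≤∣i∣ (ceiling p))))))))
  where
  i≤∣i∣ : ∀ i → i ℤ.≤ ℤ.+ ℤ.∣ i ∣
  i≤∣i∣ (ℤ.+ i)    = ℤ.≤-refl
  i≤∣i∣ -[1+ i ] = ℤ.-≤+

ℕ→ℚ-mono : ∀ {k l} → k ℕ.≤ l → ℕ→ℚ k ℚ.≤ ℕ→ℚ l
ℕ→ℚ-mono {l = l} ℕ.z≤n = Σ-nonneg l λ _ → ℚ.nonNegative⁻¹ 1ℚ
ℕ→ℚ-mono (ℕ.s≤s k≤l)   = ℚ.+-monoʳ-≤ 1ℚ (ℕ→ℚ-mono k≤l)

indicator : Subset n → Fin n → ℚ
indicator e v = at (lookup e v) 1ℚ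

indicator-nonneg : (e : Subset n) → ∀ v → 0ℚ ℚ.≤ indicator e v
indicator-nonneg e v with lookup e v
... | true  = ℚ.nonNegative⁻¹ 1ℚ
... | false = ℚ.≤-refl

at≡indicator* : (e : Subset n) → ∀ v x → at (lookup e v) x ≡ indicator e v * x
at≡indicator* e v x with lookup e v
... | true  = sym (ℚ.*-identityˡ x)
... | false = sym (ℚ.*-zeroˡ x)

Σ-indicator : (e : Subset n) → Σ[ n ] (indicator e) ≡ ℕ→ℚ Subset.∣ e ∣
Σ-indicator []          = refl
Σ-indicator (true  ∷ e) = cong (1ℚ +_) (Σ-indicator e)
Σ-indicator (false ∷ e) = trans (ℚ.+-identityˡ _) (Σ-indicator e)

∙-comm : (x y : Fin n → ℚ) → x ∙ y ≡ y ∙ x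
∙-comm x y = Σ-cong λ v → ℚ.*-comm (x v) (y v)

-- If there were none, w would be a fractional cover smaller than a fractional matching.
uncovered-edge : ∀ (E : List (Subset n)) {q} → νStar≥ E q →
  (w : Fin n → ℚ) → (∀ v → 0ℚ ℚ.≤ w v) → Σ[ n ] w < q → ∃ λ e → e ∈ E × w ∙ indicator e < 1ℚ
uncovered-edge {n} E {q} (f , (f≥0 , cap) , q≤size) w w≥0 w<q
  with any? (λ j → w ∙ indicator (List.lookup E j) ℚ.<? 1ℚ)
... | yes (j , lt) = List.lookup E j , ∈-lookup j , lt
... | no none = ⊥-elim (ℚ.<-irrefl refl (ℚ.<-≤-trans w<q (ℚ.≤-trans q≤size (begin
  Σ[ k ] f                                                   ≤⟨ Σ-mono k covered ⟩
  Σ[ k ] (λ j → indicator (e j) ∙ w * f j)                   ≡⟨ combination-∙ (indicator ∘ e) f w ⟨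
  Σ[ n ] (λ v → Σ[ k ] (λ j → indicator (e j) v * f j) * w v) ≤⟨ Σ-mono n saturated ⟩
  Σ[ n ] w                                                   ∎))))
  where
  open ℚ.≤-Reasoning
  k : ℕ
  k = List.length E
  e : Fin k → Subset n
  e = List.lookup E
  covered : ∀ j → f j ℚ.≤ indicator (e j) ∙ w * f j
  covered j = subst (ℚ._≤ indicator (e j) ∙ w * f j) (ℚ.*-identityˡ (f j))
    (ℚ.*-monoʳ-≤-nonNeg (f j) {{nonNegative (f≥0 j)}}
      (subst (1ℚ ℚ.≤_) (∙-comm w (indicator (e j))) (ℚ.≮⇒≥ (λ lt → none (j , lt)))))
  saturated : ∀ v → Σ[ k ] (λ j → indicator (e j) v * f j) * w v ℚ.≤ w v
  saturated v = subst (Σ[ k ] (λ j → indicator (e j) v * f j) * w v ℚ.≤_) (ℚ.*-identityˡ (w v))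
    (ℚ.*-monoʳ-≤-nonNeg (w v) {{nonNegative (w≥0 v)}}
      (subst (ℚ._≤ 1ℚ) (Σ-cong λ j → at≡indicator* (e j) v (f j)) (cap v)))

-- For a basis this lists the positions of the edge columns among the slack ones: the rainbow
-- matching to be returned is indexed by `Fin count`.
record RightPositions {A B : Set} (β : Fin n → A ⊎ B) : Set where
  field
    count        : ℕ
    position     : Fin count → Fin n
    value        : Fin count → B
    injective    : Injective _≡_ _≡_ position
    β-position   : ∀ j → β (position j) ≡ inj₂ (value j)
    exhaustive   : ∀ i b → β i ≡ inj₂ b → ∃ λ j → position j ≡ i
    Σ-restrict   : (f : Fin n → ℚ) → (∀ i a → β i ≡ inj₁ a → f i ≡ 0ℚ) →
                   Σ[ n ] f ≡ Σ[ count ] (f ∘ position)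

right-positions : {A B : Set} (β : Fin n → A ⊎ B) → RightPositions β
right-positions {zero} β = record
  { count = 0 ; position = λ () ; value = λ () ; injective = λ { {()} } ; β-position = λ ()
  ; exhaustive = λ () ; Σ-restrict = λ _ _ → refl }
right-positions {suc n} β with right-positions (β ∘ suc) | β zero in eq
... | R | inj₁ a = record
  { count      = count
  ; position   = suc ∘ position
  ; value      = value
  ; injective  = injective ∘ suc-injective
  ; β-position = β-position
  ; exhaustive = λ { zero b eq′ → contradiction (trans (sym eq) eq′) λ ()
                   ; (suc i) b eq′ → let j , jeq = exhaustive i b eq′ in j , cong suc jeq }
  ; Σ-restrict = λ f f≡0 → trans (cong₂ _+_ (f≡0 zero a eq) (Σ-restrict (f ∘ suc) (f≡0 ∘ suc)))
                                 (ℚ.+-identityˡ _)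
  }
  where open RightPositions R
... | R | inj₂ b₀ = record
  { count      = suc count
  ; position   = λ { zero → zero ; (suc j) → suc (position j) }
  ; value      = λ { zero → b₀ ; (suc j) → value j }
  ; injective  = λ { {zero} {zero} _ → refl ; {suc i} {suc j} e → cong suc (injective (suc-injective e)) }
  ; β-position = λ { zero → eq ; (suc j) → β-position j }
  ; exhaustive = λ { zero b eq′ → zero , refl
                   ; (suc i) b eq′ → let j , jeq = exhaustive i b eq′ in suc j , cong suc jeq }
  ; Σ-restrict = λ f f≡0 → cong (f zero +_) (Σ-restrict (f ∘ suc) (f≡0 ∘ suc))
  }
  where open RightPositions R

-- Rainbow pivoting

-- The columns of the linear program: slack variables, and edges with their colours.
Column : ℕ → ℕ → Set
Column V m = Fin V ⊎ (Fin m × Subset V)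

entries : ∀ {V m} → Column V m → Fin V → ℚ
entries (inj₁ u)       = δ u
entries (inj₂ (i , e)) = indicator e

cost : ∀ {V m} → Column V m → ℚ
cost (inj₁ _) = 0ℚ
cost (inj₂ _) = 1ℚ

δ-nonneg : (k l : Fin n) → 0ℚ ℚ.≤ δ k l
δ-nonneg zero    zero    = ℚ.nonNegative⁻¹ 1ℚ
δ-nonneg zero    (suc l) = ℚ.≤-refl
δ-nonneg (suc k) zero    = ℚ.≤-refl
δ-nonneg (suc k) (suc l) = δ-nonneg k l

Σ-δ-one : (k : Fin n) → Σ[ n ] (δ k) ≡ 1ℚ
Σ-δ-one k = trans (Σ-cong λ v → sym (ℚ.*-identityʳ (δ k v))) (Σ-δ k (const 1ℚ))

entries-nonneg : ∀ {V m} (q : Column V m) v → 0ℚ ℚ.≤ entries q v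
entries-nonneg (inj₁ u)       = δ-nonneg u
entries-nonneg (inj₂ (i , e)) = indicator-nonneg e

-- Coding the columns by a finite set

subset-code : Subset n → Fin (2 ℕ.^ n)
subset-code []          = zero
subset-code (true  ∷ e) = combine {2} zero (subset-code e)
subset-code (false ∷ e) = combine {2} (suc zero) (subset-code e)

subset-code-injective : Injective _≡_ _≡_ (subset-code {n})
subset-code-injective {x = []}        {[]}        eq = refl
subset-code-injective {x = true ∷ e}  {true ∷ e′} eq =
  cong (true ∷_) (subset-code-injective (proj₂ (combine-injective {2} zero (subset-code e) zero _ eq)))
subset-code-injective {x = true ∷ e}  {false ∷ e′} eq =
  contradiction (proj₁ (combine-injective {2} zero (subset-code e) (suc zero) _ eq)) λ ()
subset-code-injective {x = false ∷ e} {true ∷ e′} eq =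
  contradiction (proj₁ (combine-injective {2} (suc zero) (subset-code e) zero _ eq)) λ ()
subset-code-injective {x = false ∷ e} {false ∷ e′} eq =
  cong (false ∷_) (subset-code-injective (proj₂ (combine-injective {2} (suc zero) (subset-code e) (suc zero) _ eq)))

join-injective : ∀ m n {x y : Fin m ⊎ Fin n} → join m n x ≡ join m n y → x ≡ y
join-injective m n {x} {y} eq =
  trans (sym (splitAt-join m n x)) (trans (cong (splitAt m) eq) (splitAt-join m n y))

column-code : ∀ {V m} → Column V m → Fin (V ℕ.+ m ℕ.* 2 ℕ.^ V)
column-code {V} {m} = join V (m ℕ.* 2 ℕ.^ V) ∘ Sum.map₂ λ (i , e) → combine i (subset-code e)

column-code-injective : ∀ {V m} → Injective _≡_ _≡_ (column-code {V} {m})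
column-code-injective {V} {m} {q} {q′} eq = summands q q′ (join-injective V (m ℕ.* 2 ℕ.^ V) eq)
  where
  summands : ∀ q q′ → Sum.map₂ (λ (i , e) → combine i (subset-code e)) q ≡
    Sum.map₂ (λ (i , e) → combine i (subset-code e)) q′ → q ≡ q′
  summands (inj₁ u)       (inj₁ u′)        eq = cong inj₁ (inj₁-injective eq)
  summands (inj₂ (i , e)) (inj₂ (i′ , e′)) eq
    with refl , eq′ ← combine-injective i (subset-code e) i′ (subset-code e′) (inj₂-injective eq)
    = cong (λ e → inj₂ (i , e)) (subset-code-injective eq′)

module RainbowSimplex {V m r : ℕ} (E : Fin m → List (Subset V)) (uniform : ∀ i → All (IsEdge r) (E i))
  (0<r : 0 ℕ.< r) (n : ℚ) (0<n : 0ℚ < n) (rn≤m : ℕ→ℚ r * n ℚ.≤ ℕ→ℚ m)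
  (fractional : ∀ i → νStar≥ (E i) n) where

  open Simplex {Column V m} {V} entries cost

  record Rainbow (β : Fin V → Column V m) : Set where
    field
      member   : ∀ {k i e} → β k ≡ inj₂ (i , e) → e ∈ E i
      distinct : ∀ {k l i e e′} → β k ≡ inj₂ (i , e) → β l ≡ inj₂ (i , e′) → k ≡ l

  open Rainbow

  module _ {β : Fin V → Column V m} (rainbow : Rainbow β) (q : Column V m)
    (q-member : ∀ {i e} → q ≡ inj₂ (i , e) → e ∈ E i)
    (q-unused : ∀ {i e k e′} → q ≡ inj₂ (i , e) → β k ≢ inj₂ (i , e′)) (p : Fin V) where

    -- The colour of `q` is absent from all of `β`, so no clash can arise whichever position is
    -- vacated; this is the stability that `simplex` asks for.
    exchange-rainbow : Rainbow (exchange β p q)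
    exchange-rainbow = record { member = member′ ; distinct = distinct′ }
      where
      at-p : ∀ {k} → k ≡ p → exchange β p q k ≡ q
      at-p refl = updateAt-updates p β
      off-p : ∀ {k} → k ≢ p → exchange β p q k ≡ β k
      off-p {k} k≢p = updateAt-minimal k p β k≢p
      member′ : ∀ {k i e} → exchange β p q k ≡ inj₂ (i , e) → e ∈ E i
      member′ {k} eq with k ≟ p
      ... | yes k≡p = q-member (trans (sym (at-p k≡p)) eq)
      ... | no  k≢p = member rainbow (trans (sym (off-p k≢p)) eq)
      distinct′ : ∀ {k l i e e′} →
        exchange β p q k ≡ inj₂ (i , e) → exchange β p q l ≡ inj₂ (i , e′) → k ≡ l
      distinct′ {k} {l} eq eq′ with k ≟ p | l ≟ p
      ... | yes k≡p | yes l≡p = trans k≡p (sym l≡p)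
      ... | yes k≡p | no  l≢p = contradiction (trans (sym (off-p l≢p)) eq′) (q-unused (trans (sym (at-p k≡p)) eq))
      ... | no  k≢p | yes l≡p = contradiction (trans (sym (off-p k≢p)) eq) (q-unused (trans (sym (at-p l≡p)) eq′))
      ... | no  k≢p | no  l≢p = distinct rainbow (trans (sym (off-p k≢p)) eq) (trans (sym (off-p l≢p)) eq′)

  slack-tableau : Tableau inj₁
  slack-tableau = record
    { ρ        = δ
    ; left     = λ k l → trans (Σ-δ k (δ l)) (δ-sym l k)
    ; right    = λ u v → trans (Σ-cong λ k → cong (_* δ k v) (δ-sym k u)) (Σ-δ u (λ k → δ k v))
    ; feasible = λ k → inj₁ (subst (0ℚ <_) (sym (Σ-δ-one k)) (ℚ.positive⁻¹ 1ℚ))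
    }

  slack-rainbow : Rainbow inj₁
  slack-rainbow = record { member = λ () ; distinct = λ () }

  edge-size : ∀ {i e} → e ∈ E i → Σ[ V ] (indicator e) ≡ ℕ→ℚ r
  edge-size {i} {e} e∈E = trans (Σ-indicator e) (cong ℕ→ℚ (All.lookup (uniform i) e∈E))

  -- One step of the rainbow simplex method

  module Step {β : Fin V → Column V m} (T : Tableau β) (rainbow : Rainbow β) where
    open Tableau T
    open RightPositions (right-positions β)

    one : Fin V → ℚ
    one _ = 1ℚ

    -- The basic solution at the unperturbed right-hand side, which is the leading coefficient in
    -- `feasible`.
    x : Fin V → ℚ
    x k = ρ k ∙ one

    total : ℚ
    total = Σ[ V ] weight

    x-nonneg : ∀ k → 0ℚ ℚ.≤ x k
    x-nonneg k = subst (0ℚ ℚ.≤_) (Σ-cong λ v → sym (ℚ.*-identityʳ (ρ k v)))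
      ([ ℚ.<⇒≤ , (λ z → ℚ.≤-reflexive (sym (proj₁ z))) ]′ (feasible k))

    saturated : ∀ v → Σ[ V ] (λ k → x k * entries (β k) v) ≡ 1ℚ
    saturated = expansion one

    term-nonneg : ∀ v k → 0ℚ ℚ.≤ x k * entries (β k) v
    term-nonneg v k = *-nonneg (x-nonneg k) (entries-nonneg (β k) v)

    -- Strong duality at a basis: the value of the basic solution and the sum of the dual weights
    -- are one double sum, ordered in two ways.
    total≡ : Σ[ V ] (λ k → x k * cost (β k)) ≡ total
    total≡ = trans (sym (combination-∙ ρ (cost ∘ β) one)) (Σ-cong λ v → ℚ.*-identityʳ (weight v))

    count≡ : Σ[ V ] (cost ∘ β) ≡ ℕ→ℚ count
    count≡ = trans (Σ-restrict (cost ∘ β) (λ i a eq → cong cost eq)) (Σ-cong λ j → cong cost (β-position j))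

    -- At the vertex `u` the slack contributes `x k` to a sum of nonnegative terms equal to 1.
    slack≤1 : ∀ k u → β k ≡ inj₁ u → x k ℚ.≤ 1ℚ
    slack≤1 k u eq = subst₂ ℚ._≤_
      (trans (cong (x k *_) (trans (cong (λ j → entries j u) eq) (δ-refl u))) (ℚ.*-identityʳ (x k)))
      (saturated u) (term≤Σ V (term-nonneg u) k)

    -- Summed over all k, the first terms give V because x saturates every vertex.
    column-bound : ∀ k → x k * Σ[ V ] (entries (β k)) + cost (β k) ℚ.≤ 1ℚ + ℕ→ℚ r * (x k * cost (β k))
    column-bound k with β k in eq
    ... | inj₁ u = subst₂ ℚ._≤_
      (trans (lemma (x k)) (cong (λ s → x k * s + 0ℚ) (sym (Σ-δ-one u)))) (lemma′ (ℕ→ℚ r) (x k)) (slack≤1 k u eq)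
      where
      lemma : ∀ x → x ≡ x * 1ℚ + 0ℚ
      lemma = solve-∀ ℚ-ring
      lemma′ : ∀ r x → 1ℚ ≡ 1ℚ + r * (x * 0ℚ)
      lemma′ = solve-∀ ℚ-ring
    ... | inj₂ (i , e) = ℚ.≤-reflexive
      (trans (cong (λ s → x k * s + 1ℚ) (edge-size (member rainbow eq))) (lemma (x k) (ℕ→ℚ r)))
      where
      lemma : ∀ x r → x * r + 1ℚ ≡ 1ℚ + r * (x * 1ℚ)
      lemma = solve-∀ ℚ-ring

    -- Sum `column-bound` over the basis, which has exactly `V` columns; the `V` on each side
    -- cancels. Slack columns enter with value at most 1, edge columns with exactly `r` incidences.
    count-bound : ℕ→ℚ count ℚ.≤ ℕ→ℚ r * total
    count-bound = +-cancelˡ-≤ (ℕ→ℚ V) (begin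
      ℕ→ℚ V + ℕ→ℚ count
        ≡⟨ cong₂ _+_ (Σ-cong λ v → sym (saturated v)) (sym count≡) ⟩
      Σ[ V ] (λ v → Σ[ V ] (λ k → x k * entries (β k) v)) + Σ[ V ] (cost ∘ β)
        ≡⟨ cong (λ s → s + Σ[ V ] (cost ∘ β)) (trans (Σ-swap V V (λ v k → x k * entries (β k) v))
             (Σ-cong λ k → Σ-*ˡ V (x k) (entries (β k)))) ⟩
      Σ[ V ] (λ k → x k * Σ[ V ] (entries (β k))) + Σ[ V ] (cost ∘ β) ≡⟨ Σ-+ V _ (cost ∘ β) ⟨
      Σ[ V ] (λ k → x k * Σ[ V ] (entries (β k)) + cost (β k))       ≤⟨ Σ-mono V column-bound ⟩
      Σ[ V ] (λ k → 1ℚ + ℕ→ℚ r * (x k * cost (β k)))                 ≡⟨ Σ-+ V one _ ⟩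
      ℕ→ℚ V + Σ[ V ] (λ k → ℕ→ℚ r * (x k * cost (β k)))
        ≡⟨ cong (λ s → ℕ→ℚ V + s) (trans (Σ-*ˡ V (ℕ→ℚ r) (λ k → x k * cost (β k))) (cong (ℕ→ℚ r *_) total≡)) ⟩
      ℕ→ℚ V + ℕ→ℚ r * total                                          ∎)
      where open ℚ.≤-Reasoning

    finish : n ℚ.≤ total → RainbowFracMatching E n
    finish n≤total = count , proj₁ ∘ value , proj₂ ∘ value , f , colours-distinct ,
      (λ j → member rainbow (β-position j)) , (f-nonneg , capacity) , f-size
      where
      open ℚ.≤-Reasoning
      0<total : 0ℚ < total
      0<total = ℚ.<-≤-trans 0<n n≤total
      scale : ℚ
      scale = n * recip total
      scale-total : scale * total ≡ n
      scale-total = trans (ℚ.*-assoc n (recip total) total)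
        (trans (cong (n *_) (recip-inverse 0<total)) (ℚ.*-identityʳ n))
      0<scale : 0ℚ < scale
      0<scale = *-pos 0<n (recip-pos 0<total)
      scale≤1 : scale ℚ.≤ 1ℚ
      scale≤1 = ℚ.*-cancelʳ-≤-pos total {{positive 0<total}}
        (subst₂ ℚ._≤_ (sym scale-total) (sym (ℚ.*-identityˡ total)) n≤total)
      f : Fin count → ℚ
      f j = scale * x (position j)
      colours-distinct : Injective _≡_ _≡_ (proj₁ ∘ value)
      colours-distinct {i} {j} eq = injective
        (distinct rainbow (β-position i) (trans (β-position j) (cong (λ c → inj₂ (c , proj₂ (value j))) (sym eq))))
      f-nonneg : ∀ j → 0ℚ ℚ.≤ f j
      f-nonneg j = *-nonneg (ℚ.<⇒≤ 0<scale) (x-nonneg (position j))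
      -- The factor `cost` erases the slack columns, so that `Σ-restrict` can pass between all
      -- columns and the edge columns.
      load : Fin V → Fin V → ℚ
      load v k = cost (β k) * (x k * entries (β k) v)
      load-bound : ∀ v k → load v k ℚ.≤ x k * entries (β k) v
      load-bound v k with β k | term-nonneg v k
      ... | inj₁ u | 0≤t = subst (ℚ._≤ x k * δ u v) (sym (ℚ.*-zeroˡ (x k * δ u v))) 0≤t
      ... | inj₂ (i , e) | _ = ℚ.≤-reflexive (ℚ.*-identityˡ _)
      scaled : ∀ v j → at (lookup (proj₂ (value j)) v) (f j) ℚ.≤ load v (position j)
      scaled v j = begin
        at (lookup e v) (f j)                   ≡⟨ at≡indicator* e v (f j) ⟩
        indicator e v * (scale * x k)           ≡⟨ lemma (indicator e v) scale (x k) ⟩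
        scale * (x k * indicator e v)           ≤⟨ ℚ.*-monoʳ-≤-nonNeg (x k * indicator e v)
          {{nonNegative (*-nonneg (x-nonneg k) (indicator-nonneg e v))}} scale≤1 ⟩
        1ℚ * (x k * indicator e v)
          ≡⟨ cong (λ q → cost q * (x k * entries q v)) (β-position j) ⟨
        load v k                                ∎
        where
        k : Fin V
        k = position j
        e : Subset V
        e = proj₂ (value j)
        lemma : ∀ i s x → i * (s * x) ≡ s * (x * i)
        lemma = solve-∀ ℚ-ring
      capacity : ∀ v → Σ[ count ] (λ j → at (lookup (proj₂ (value j)) v) (f j)) ℚ.≤ 1ℚ
      capacity v = begin
        Σ[ count ] (λ j → at (lookup (proj₂ (value j)) v) (f j)) ≤⟨ Σ-mono count (scaled v) ⟩
        Σ[ count ] (load v ∘ position)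
          ≡⟨ Σ-restrict (load v) (λ i u eq → trans (cong (λ q → cost q * (x i * entries (β i) v)) eq)
               (ℚ.*-zeroˡ (x i * entries (β i) v))) ⟨
        Σ[ V ] (load v)                                          ≤⟨ Σ-mono V (load-bound v) ⟩
        Σ[ V ] (λ k → x k * entries (β k) v)                     ≡⟨ saturated v ⟩
        1ℚ                                                       ∎
      f-size : Σ[ count ] f ≡ n
      f-size = trans (Σ-*ˡ count scale (x ∘ position)) (trans (cong (scale *_) (trans
        (trans (Σ-cong λ j → trans (sym (ℚ.*-identityʳ (x (position j))))
            (cong (λ q → x (position j) * cost q) (sym (β-position j))))
          (sym (Σ-restrict (λ k → x k * cost (β k))
            λ i u eq → trans (cong (λ q → x i * cost q) eq) (ℚ.*-zeroʳ (x i)))))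
        total≡)) scale-total)

    -- Pigeonhole: if every colour occurred in the basis, then `m` would be at most `count`, hence
    -- at most `r * total`, which is less than `r * n` and so less than `m`.
    unused-colour : total < n → ∃ λ i → ∀ j → proj₁ (value j) ≢ i
    unused-colour total<n with any? (λ i → all? (λ j → ¬? (proj₁ (value j) ≟ i)))
    ... | yes found = found
    ... | no none = ⊥-elim (ℚ.<-irrefl refl (begin-strict
      ℕ→ℚ m           ≤⟨ ℕ→ℚ-mono (injective⇒≤ pick-injective) ⟩
      ℕ→ℚ count       ≤⟨ count-bound ⟩
      ℕ→ℚ r * total   <⟨ ℚ.*-monoʳ-<-pos (ℕ→ℚ r) {{positive (ℚ.<-≤-trans (ℚ.positive⁻¹ 1ℚ) (ℕ→ℚ-mono 0<r))}} total<n ⟩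
      ℕ→ℚ r * n       ≤⟨ rn≤m ⟩
      ℕ→ℚ m           ∎))
      where
      open ℚ.≤-Reasoning
      used : ∀ i → ∃ λ j → proj₁ (value j) ≡ i
      used i with any? (λ j → proj₁ (value j) ≟ i)
      ... | yes found = found
      ... | no none′  = contradiction (i , λ j eq → none′ (j , eq)) none
      pick-injective : Injective _≡_ _≡_ (proj₁ ∘ used)
      pick-injective {i} {j} eq =
        trans (sym (proj₂ (used i))) (trans (cong (proj₁ ∘ value) eq) (proj₂ (used j)))

    Entering : Column V m → Set
    Entering q = 0ℚ < Σ[ V ] (entries q) × weight ∙ entries q < cost q × (∀ p → Rainbow (exchange β p q))

    -- A slack column has cost 0 and price `weight v`, so a negative weight is a positive reduced
    -- cost.
    enter-slack : ∀ v → weight v < 0ℚ → Entering (inj₁ v)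
    enter-slack v w<0 = subst (0ℚ <_) (sym (Σ-δ-one v)) (ℚ.positive⁻¹ 1ℚ) ,
      subst (_< 0ℚ) (sym (trans (∙-comm weight (δ v)) (Σ-δ v weight))) w<0 ,
      exchange-rainbow rainbow (inj₁ v) (λ ()) (λ ())

    enter-edge : (∀ v → 0ℚ ℚ.≤ weight v) → total < n → ∃ Entering
    enter-edge w≥0 total<n =
      let i , unused         = unused-colour total<n
          e , e∈E , uncovered = uncovered-edge (E i) (fractional i) weight w≥0 total<n
      in inj₂ (i , e) ,
         subst (0ℚ <_) (sym (edge-size e∈E)) (ℚ.<-≤-trans (ℚ.positive⁻¹ 1ℚ) (ℕ→ℚ-mono 0<r)) ,
         uncovered ,
         exchange-rainbow rainbow (inj₂ (i , e)) (λ { refl → e∈E })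
           (λ { {k = k} {e′} refl eq → let j , at-k = exhaustive k (i , e′) eq in
                unused j (cong proj₁ (inj₂-injective (trans (sym (β-position j)) (trans (cong β at-k) eq)))) })

    -- Negative weights are removed first, since only nonnegative weights can serve as a fractional
    -- cover in `uncovered-edge`.
    step : RainbowFracMatching E n ⊎ ∃ Entering
    step with any? (λ v → weight v ℚ.<? 0ℚ)
    ... | yes (v , w<0) = inj₂ (inj₁ v , enter-slack v w<0)
    ... | no w≮0 with n ℚ.≤? total
    ...   | yes n≤total = inj₁ (finish n≤total)
    ...   | no n≰total  = inj₂ (enter-edge (λ v → ℚ.≮⇒≥ (λ lt → w≮0 (v , lt))) (ℚ.≰⇒> n≰total))

  rainbow-matching : RainbowFracMatching E n
  rainbow-matching =
    simplex entries-nonneg column-code column-code-injective Rainbow Step.step slack-tableau slack-rainbow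

open import Data.Integer using (+_; ∣_∣)

theorem6 : (r : ℕ) → 2 ≤ r → (n : ℚ) → Positive n → (V : ℕ)
    → (E : Fin ∣ (ceiling (((+ r) / 1) * n)) ∣ → List (Subset V))
    → (∀ i → All (IsEdge r) (E i))
    → (∀ i → νStar≥ (E i) n)
    → RainbowFracMatching E n
theorem6 r 2≤r n n>0 V E uniform fractional =
  RainbowSimplex.rainbow-matching E uniform (ℕ.<-≤-trans (ℕ.s≤s ℕ.z≤n) 2≤r) n (ℚ.positive⁻¹ n {{n>0}})
    -- The number of colours is at least `r * n`, with `r` converted from a fraction over 1 to a sum
    -- of ones.
    (subst (λ q → q * n ℚ.≤ ℕ→ℚ ∣ ceiling (((+ r) / 1) * n) ∣) (sym (ℕ→ℚ≡/1 r))
      (≤-∣ceiling∣ (((+ r) / 1) * n)))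
    fractional
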